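{- For every positive integer $d$, the Eulerian polynomial satisfies $$A_d(x)=\sum_{\pi\in\mathfrak{S}_d}x^{1+\mathrm{des}(\pi)}=\sum_{j=0}^{d!-1}x^{\,j+1-\sum_{i=0}^{d-2}\left\lfloor\frac{j}{i!\,(i+2)}\right\rfloor}.$$
   Context: $\mathfrak{S}_d$ is the set of permutations $\pi=\pi_1\cdots\pi_d$ of $\{1,\ldots,d\}$, and $\mathrm{des}(\pi)$ is the number of $j\in\{1,\ldots,d-1\}$ with $\pi_j>\pi_{j+1}$. An empty sum is $0$. -}

module Defs where

open import Data.Nat using (ℕ; zero; suc; _+_; _*_; _∸_; _<ᵇ_; _!; _/_; NonZero)
open import Data.Nat.Properties using (m*n≢0; _!≢0)
import Data.Nat.Base as NB
open import Data.Integer as ℤ using (ℤ; +_; _-_)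
import Data.Integer.Properties as ℤP
open import Data.Fin using (Fin; toℕ)
open import Data.Bool using (Bool; true; false; if_then_else_)
open import Data.List using (List; []; _∷_; map; filter; length; concatMap; upTo)
open import Data.Nat.ListAction using (sum)
open import Data.List.Relation.Unary.Unique.Propositional using (Unique)
open import Data.List.Relation.Unary.Unique.DecPropositional using (unique?)
open import Data.Fin.Properties using () renaming (_≟_ to _≟F_)
open import Relation.Nullary.Decidable using (⌊_⌋)

words : (d n : ℕ) → List (List (Fin d))
words d zero    = [] ∷ []
words d (suc n) = concatMap (λ w → map (λ a → a ∷ w) (Data.List.allFin d)) (words d n)
  where import Data.List

-- The symmetric group S_d, as the list of all permutations in one-line
-- notation: words of length d over {0,…,d-1} with no repeated letter.
-- (Letters are 0-based; this relabelling a ↦ a+1 does not affect descents.)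
perms : (d : ℕ) → List (List (Fin d))
perms d = filter (unique? _≟F_) (words d d)

des : ∀ {d} → List (Fin d) → ℕ
des []           = 0
des (a ∷ [])     = 0
des (a ∷ b ∷ w)  = (if toℕ b <ᵇ toℕ a then 1 else 0) + des (b ∷ w)

-- A (Laurent) polynomial with natural coefficients given as a formal sum
-- Σ_{e ∈ es} x^e of monomials; its coefficient of x^k is the number of
-- occurrences of k in es.  Two such polynomials are equal iff all
-- coefficients agree.
coeff : List ℤ → ℤ → ℕ
coeff es k = length (filter (λ e → e ℤ.≟ k) es)

eulerianExps : ℕ → List ℤ
eulerianExps d = map (λ π → + (1 + des π)) (perms d)

floorTerm : ℕ → ℕ → ℕ
floorTerm j i = (j / (i ! * (2 + i))) {{m*n≢0 (i !) (2 + i) {{i !≢0}}}}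

rhsExp : ℕ → ℕ → ℤ
rhsExp d j = + (j + 1) - + sum (map (floorTerm j) (upTo (d ∸ 1)))

rhsExps : ℕ → List ℤ
rhsExps d = map (rhsExp d) (upTo (d !))

-- Write 0 ≤ j < d! in the factorial number system, with digits e_i = ⌊j / i!⌋ mod (i+1).
-- Splitting x = ⌊j / i!⌋ into its two lowest mixed-radix digits e_i, e_{i+1} gives
--   ⌊j / (i! (i+2))⌋ = ⌊j / (i+1)!⌋ − ⌊j / (i+2)!⌋ − [e_i < e_{i+1}],
-- so the floor sum telescopes to j minus the number of descents of the digit word
-- e_{d-1} … e_0.  Reading that word as a Lehmer code (first letter e_{d-1}, followed by
-- the permutation coded by the remaining digits, relabelled around e_{d-1}) is a
-- bijection [0, d!) → S_d that preserves descents.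
module Submission where

open import Defs
open import Data.Bool using (true; false; if_then_else_)
open import Data.Empty using (⊥-elim)
open import Data.Fin using (Fin; zero; suc; toℕ; punchIn; punchOut)
import Data.Fin.Properties as Fin
open import Data.Fin.Properties using (toℕ<n; punchIn-injective; punchInᵢ≢i; punchIn-punchOut)
import Data.Integer as ℤ
open import Data.Integer using (ℤ; _-_; _⊖_)
open import Data.Integer.Properties using ([+m]-[+n]≡m⊖n; ⊖-≥)
open import Data.List using (List; []; _∷_; [_]; _++_; map; length; concatMap; upTo; applyUpTo; tabulate; allFin; cartesianProductWith)
open import Data.List.Properties using (map-++; map-∘; map-cong; map-cong-local; map-injective; map-upTo; map-tabulate; upTo-∷ʳ; concatMap-++; ++-identityʳ; length-map; ∷-injective)
open import Data.List.Membership.Propositional using (_∈_)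
open import Data.List.Membership.Propositional.Properties using (∈-upTo⁻; ∈-map⁺; ∈-map⁻; ∈-allFin; ∈-filter⁺; ∈-filter⁻; ∈-cartesianProductWith⁺; ∈-cartesianProductWith⁻)
open import Data.List.Membership.Propositional.Properties.WithK using (unique∧set⇒bag)
open import Data.List.Relation.Binary.BagAndSetEquality using (∼bag⇒↭)
open import Data.List.Relation.Binary.Permutation.Propositional using (_↭_)
open import Data.List.Relation.Binary.Permutation.Propositional.Properties using (map⁺; filter-↭; ↭-length)
open import Data.List.Relation.Unary.All using (All; []; _∷_)
import Data.List.Relation.Unary.All as All
open import Data.List.Relation.Unary.AllPairs using ([]; _∷_)
open import Data.List.Relation.Unary.Any using (here)
open import Data.List.Relation.Unary.Unique.Propositional using (Unique)
import Data.List.Relation.Unary.Unique.Propositional.Properties as Unique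
open import Data.List.Relation.Unary.Unique.DecPropositional using (unique?)
open import Data.Nat using (ℕ; zero; suc; _+_; _*_; _∸_; _<ᵇ_; _≤_; _<_; s≤s; z≤n; _<?_; _!; _/_; _%_; NonZero)
open import Data.Nat.DivMod using (m≡m%n+[m/n]*n; /-congˡ; /-congʳ; n/1≡n; m*n/n≡m; m<n⇒m/n≡0; m%n<n; m≤n⇒m%n≡m; [m+kn]%n≡m%n; +-distrib-/-∣ˡ; +-distrib-/-∣ʳ; m/n/o≡m/[n*o])
open import Data.Nat.Divisibility using (divides; divides-refl; m≤n⇒m!∣n!)
open import Data.Nat.ListAction using (sum)
open import Data.Nat.ListAction.Properties using (sum-++)
open import Data.Nat.Properties using (+-comm; +-assoc; +-identityʳ; +-suc; *-comm; *-suc; suc-injective; ≤-refl; ≤-trans; ≤-reflexive; <⇒≤; <-≤-trans; ≤⇒≯; ≮⇒≥; m<1+n⇒m≤n; m<n⇒m<1+n; m≤m+n; m∸n≤m; m∸n+n≡m; m+n∸n≡m; m+n∸m≡n; ∸-monoʳ-≤; +-monoʳ-<; +-monoˡ-≤; *-monoˡ-≤; <⇒<ᵇ; <ᵇ⇒<; m*n≢0; _!≢0)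
open import Data.Nat.Tactic.RingSolver using (solve-∀)
open import Data.Product using (_,_; _×_; ∃-syntax)
open import Function using (_∘_; id)
open import Function.Bundles using (mk⇔)
open import Relation.Nullary using (yes; no)
open import Relation.Binary.PropositionalEquality using (_≡_; _≢_; refl; sym; trans; cong; cong₂; subst; module ≡-Reasoning)
open ≡-Reasoning

-- Factorial-base digits and the floor sum

descent : ℕ → ℕ → ℕ
descent a b = if b <ᵇ a then 1 else 0

descent-< : ∀ {a b} → b < a → descent a b ≡ 1
descent-< {a} {b} b<a with b <ᵇ a | <⇒<ᵇ b<a
... | true | _ = refl

descent-≤ : ∀ {a b} → a ≤ b → descent a b ≡ 0
descent-≤ {a} {b} a≤b with b <ᵇ a | <ᵇ⇒< b a
... | false | _   = refl
... | true  | b<a = ⊥-elim (≤⇒≯ a≤b (b<a _))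

[m+kn]/n≡m/n+k : ∀ m k n .{{_ : NonZero n}} → (m + k * n) / n ≡ m / n + k
[m+kn]/n≡m/n+k m k n = trans (+-distrib-/-∣ʳ m (divides-refl k)) (cong (m / n +_) (m*n/n≡m k n))

m≡r+q*n⇒m/n≡q : ∀ {m q r} n → r < suc n → m ≡ r + q * suc n → m / suc n ≡ q
m≡r+q*n⇒m/n≡q {q = q} {r} n r<1+n refl = trans ([m+kn]/n≡m/n+k r q (suc n)) (cong (_+ q) (m<n⇒m/n≡0 r<1+n))

m+n*k≡m∸n+n*[1+k] : ∀ {m n} k → n ≤ m → m + n * k ≡ m ∸ n + n * suc k
m+n*k≡m∸n+n*[1+k] {m} {n} k n≤m = begin
  m + n * k            ≡⟨ cong (_+ n * k) (m∸n+n≡m n≤m) ⟨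
  m ∸ n + n + n * k    ≡⟨ +-assoc (m ∸ n) n (n * k) ⟩
  m ∸ n + (n + n * k)  ≡⟨ cong (m ∸ n +_) (*-suc n k) ⟨
  m ∸ n + n * suc k    ∎

digit-pair-quotient : ∀ n {b e} → b < n → e ≤ n → (e * n + b) / suc n + descent e b ≡ e
digit-pair-quotient n {b} {e} b<n e≤n with b <? e
... | no b≮e = trans (cong₂ _+_ (m≡r+q*n⇒m/n≡q n r<1+n split) (descent-≤ e≤b)) (+-identityʳ e)
  where
  e≤b = ≮⇒≥ b≮e
  r<1+n : b ∸ e < suc n
  r<1+n = s≤s (≤-trans (m∸n≤m b e) (<⇒≤ b<n))
  split : e * n + b ≡ b ∸ e + e * suc n
  split = trans (+-comm (e * n) b) (m+n*k≡m∸n+n*[1+k] n e≤b)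
... | yes (s≤s {n = e′} b≤e′) = trans (cong₂ _+_ (m≡r+q*n⇒m/n≡q n r<1+n split) (descent-< (s≤s b≤e′))) (+-comm e′ 1)
  where
  r<1+n : n + b ∸ e′ < suc n
  r<1+n = s≤s (≤-trans (∸-monoʳ-≤ (n + b) b≤e′) (≤-reflexive (m+n∸n≡m n b)))
  shuffle : ∀ e′ n b → suc e′ * n + b ≡ n + b + e′ * n
  shuffle = solve-∀
  split : suc e′ * n + b ≡ n + b ∸ e′ + e′ * suc n
  split = trans (shuffle e′ n b) (m+n*k≡m∸n+n*[1+k] n (≤-trans (<⇒≤ e≤n) (m≤m+n n b)))

quotient-telescope : ∀ x n .{{_ : NonZero n}} →
                     x / suc n + descent ((x / n) % suc n) (x % n) + x / n / suc n ≡ x / n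
quotient-telescope x n = begin
  x / suc n + descent e b + c                        ≡⟨ cong (λ y → y + descent e b + c) x/1+n ⟩
  (e * n + b) / suc n + c * n + descent e b + c      ≡⟨ rearrange ((e * n + b) / suc n) (c * n) (descent e b) c ⟩
  ((e * n + b) / suc n + descent e b) + (c + c * n)  ≡⟨ cong₂ _+_ e-digit (sym (*-suc c n)) ⟩
  e + c * suc n                                      ≡⟨ m≡m%n+[m/n]*n a (suc n) ⟨
  a                                                  ∎
  where
  a = x / n
  b = x % n
  c = a / suc n
  e = a % suc n
  e-digit : (e * n + b) / suc n + descent e b ≡ e
  e-digit = digit-pair-quotient n (m%n<n x n) (m<1+n⇒m≤n (m%n<n a (suc n)))
  rearrange : ∀ q r s t → q + r + s + t ≡ (q + s) + (t + r)
  rearrange = solve-∀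
  expand : ∀ b e c n → b + (e + c * suc n) * n ≡ (e * n + b) + c * n * suc n
  expand = solve-∀
  x/1+n : x / suc n ≡ (e * n + b) / suc n + c * n
  x/1+n = begin
    x / suc n                            ≡⟨ /-congˡ (m≡m%n+[m/n]*n x n) ⟩
    (b + a * n) / suc n                  ≡⟨ /-congˡ (cong (λ y → b + y * n) (m≡m%n+[m/n]*n a (suc n))) ⟩
    (b + (e + c * suc n) * n) / suc n    ≡⟨ /-congˡ (expand b e c n) ⟩
    (e * n + b + c * n * suc n) / suc n  ≡⟨ [m+kn]/n≡m/n+k (e * n + b) (c * n) (suc n) ⟩
    (e * n + b) / suc n + c * n          ∎

factorialQuotient : ℕ → ℕ → ℕ
factorialQuotient j zero    = j
factorialQuotient j (suc i) = factorialQuotient j i / suc i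

factorialDigit : ℕ → ℕ → ℕ
factorialDigit j i = factorialQuotient j i % suc i

factorialQuotient≡/! : ∀ j i → factorialQuotient j i ≡ (j / i !) {{i !≢0}}
factorialQuotient≡/! j zero    = sym (n/1≡n j)
factorialQuotient≡/! j (suc i) = begin
  factorialQuotient j i / suc i  ≡⟨ cong (_/ suc i) (factorialQuotient≡/! j i) ⟩
  j / i ! / suc i                ≡⟨ m/n/o≡m/[n*o] j (i !) (suc i) ⟩
  j / (i ! * suc i)              ≡⟨ /-congʳ (*-comm (i !) (suc i)) ⟩
  j / suc i !                    ∎
  where instance
  _ = i !≢0
  _ = suc i !≢0
  _ = m*n≢0 (i !) (suc i)

floorTerm≡factorialQuotient/ : ∀ j i → floorTerm j i ≡ factorialQuotient j i / (2 + i)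
floorTerm≡factorialQuotient/ j i = begin
  j / (i ! * (2 + i))              ≡⟨ m/n/o≡m/[n*o] j (i !) (2 + i) ⟨
  j / i ! / (2 + i)                ≡⟨ cong (_/ (2 + i)) (factorialQuotient≡/! j i) ⟨
  factorialQuotient j i / (2 + i)  ∎
  where instance
  _ = i !≢0
  _ = m*n≢0 (i !) (2 + i)

digitDescent : ℕ → ℕ → ℕ
digitDescent j i = descent (factorialDigit j (suc i)) (factorialDigit j i)

digitDescents : ℕ → ℕ → ℕ
digitDescents j n = sum (map (digitDescent j) (upTo n))

sum-upTo-suc : ∀ (f : ℕ → ℕ) n → sum (map f (upTo (suc n))) ≡ sum (map f (upTo n)) + f n
sum-upTo-suc f n = begin
  sum (map f (upTo (suc n)))        ≡⟨ cong (sum ∘ map f) (upTo-∷ʳ n) ⟨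
  sum (map f (upTo n ++ [ n ]))     ≡⟨ cong sum (map-++ f (upTo n) [ n ]) ⟩
  sum (map f (upTo n) ++ [ f n ])   ≡⟨ sum-++ (map f (upTo n)) [ f n ] ⟩
  sum (map f (upTo n)) + (f n + 0)  ≡⟨ cong (sum (map f (upTo n)) +_) (+-identityʳ (f n)) ⟩
  sum (map f (upTo n)) + f n        ∎

floorSum-telescope : ∀ j n →
                     sum (map (floorTerm j) (upTo n)) + digitDescents j n + factorialQuotient j (suc n) ≡ j
floorSum-telescope j zero    = n/1≡n j
floorSum-telescope j (suc n) = begin
  F (suc n) + D (suc n) + Q (2 + n)
    ≡⟨ cong₂ (λ x y → x + y + Q (2 + n)) (sum-upTo-suc (floorTerm j) n) (sum-upTo-suc (digitDescent j) n) ⟩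
  F n + floorTerm j n + (D n + digitDescent j n) + Q (2 + n)
    ≡⟨ rearrange (F n) (floorTerm j n) (D n) (digitDescent j n) (Q (2 + n)) ⟩
  F n + D n + (floorTerm j n + digitDescent j n + Q (2 + n))
    ≡⟨ cong (λ y → F n + D n + (y + digitDescent j n + Q (2 + n))) (floorTerm≡factorialQuotient/ j n) ⟩
  F n + D n + (Q n / (2 + n) + digitDescent j n + Q (2 + n))
    ≡⟨ cong (F n + D n +_) (quotient-telescope (Q n) (suc n)) ⟩
  F n + D n + Q (suc n)
    ≡⟨ floorSum-telescope j n ⟩
  j ∎
  where
  F = λ n → sum (map (floorTerm j) (upTo n))
  D = digitDescents j
  Q = factorialQuotient j
  rearrange : ∀ a b c d e → a + b + (c + d) + e ≡ a + c + (b + d + e)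
  rearrange = solve-∀

factorialQuotient-+-* : ∀ m i v → factorialQuotient (m * i ! + v) i ≡ m + factorialQuotient v i
factorialQuotient-+-* m i v = begin
  factorialQuotient (m * i ! + v) i  ≡⟨ factorialQuotient≡/! (m * i ! + v) i ⟩
  (m * i ! + v) / i !                ≡⟨ +-distrib-/-∣ˡ v (divides-refl m) ⟩
  m * i ! / i ! + v / i !            ≡⟨ cong₂ _+_ (m*n/n≡m m (i !)) (sym (factorialQuotient≡/! v i)) ⟩
  m + factorialQuotient v i          ∎
  where instance _ = i !≢0

factorialDigit-+-*-below : ∀ {i n} m v → i < n → factorialDigit (m * n ! + v) i ≡ factorialDigit v i
factorialDigit-+-*-below {i} {n} m v i<n with m≤n⇒m!∣n! i<n
... | divides k n!≡k[1+i]! = begin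
  factorialQuotient (m * n ! + v) i % suc i              ≡⟨ cong (λ x → factorialQuotient (x + v) i % suc i) m*n!≡ ⟩
  factorialQuotient (m * k * suc i * i ! + v) i % suc i  ≡⟨ cong (_% suc i) (factorialQuotient-+-* (m * k * suc i) i v) ⟩
  (m * k * suc i + factorialQuotient v i) % suc i        ≡⟨ cong (_% suc i) (+-comm (m * k * suc i) (factorialQuotient v i)) ⟩
  (factorialQuotient v i + m * k * suc i) % suc i        ≡⟨ [m+kn]%n≡m%n (factorialQuotient v i) (m * k) (suc i) ⟩
  factorialQuotient v i % suc i                          ∎
  where
  reassociate : ∀ m k i f → m * (k * (suc i * f)) ≡ m * k * suc i * f
  reassociate = solve-∀
  m*n!≡ : m * n ! ≡ m * k * suc i * i !
  m*n!≡ = trans (cong (m *_) n!≡k[1+i]!) (reassociate m k i (i !))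

factorialDigit-+-*-top : ∀ {n} m v → m ≤ n → v < n ! → factorialDigit (m * n ! + v) n ≡ m
factorialDigit-+-*-top {n} m v m≤n v<n! = begin
  factorialQuotient (m * n ! + v) n % suc n  ≡⟨ cong (_% suc n) (factorialQuotient-+-* m n v) ⟩
  (m + factorialQuotient v n) % suc n        ≡⟨ cong (λ x → (m + x) % suc n) v/n!≡0 ⟩
  (m + 0) % suc n                            ≡⟨ cong (_% suc n) (+-identityʳ m) ⟩
  m % suc n                                  ≡⟨ m≤n⇒m%n≡m m≤n ⟩
  m                                          ∎
  where
  instance _ = n !≢0
  v/n!≡0 : factorialQuotient v n ≡ 0
  v/n!≡0 = trans (factorialQuotient≡/! v n) (m<n⇒m/n≡0 v<n!)

-- Lehmer codes

data LehmerCode : ℕ → Set where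
  []  : LehmerCode 0
  _∷_ : ∀ {n} → Fin (suc n) → LehmerCode n → LehmerCode (suc n)

value : ∀ {n} → LehmerCode n → ℕ
value []            = 0
value (_∷_ {n} q c) = toℕ q * n ! + value c

value<n! : ∀ {n} (c : LehmerCode n) → value c < n !
value<n! []            = s≤s z≤n
value<n! (_∷_ {n} q c) = <-≤-trans (+-monoʳ-< (toℕ q * n !) (value<n! c)) (≤-trans
  (+-monoˡ-≤ (n !) (*-monoˡ-≤ (n !) (m<1+n⇒m≤n (toℕ<n q))))
  (≤-reflexive (+-comm (n * n !) (n !))))

decode : ∀ {n} → LehmerCode n → List (Fin n)
decode []      = []
decode (q ∷ c) = q ∷ map (punchIn q) (decode c)

descent-punchIn : ∀ {n} (q : Fin (suc n)) a b →
                  descent (toℕ (punchIn q a)) (toℕ (punchIn q b)) ≡ descent (toℕ a) (toℕ b)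
descent-punchIn zero    a       b       = refl
descent-punchIn (suc q) zero    zero    = refl
descent-punchIn (suc q) zero    (suc b) = refl
descent-punchIn (suc q) (suc a) zero    = refl
descent-punchIn (suc q) (suc a) (suc b) = descent-punchIn q a b

descent-pivot-punchIn : ∀ {n} (q : Fin (suc n)) s → descent (toℕ q) (toℕ (punchIn q s)) ≡ descent (toℕ q) (toℕ s)
descent-pivot-punchIn zero    s       = refl
descent-pivot-punchIn (suc q) zero    = refl
descent-pivot-punchIn (suc q) (suc s) = descent-pivot-punchIn q s

des-map-punchIn : ∀ {n} (q : Fin (suc n)) w → des (map (punchIn q) w) ≡ des w
des-map-punchIn q []          = refl
des-map-punchIn q (a ∷ [])    = refl
des-map-punchIn q (a ∷ b ∷ w) = cong₂ _+_ (descent-punchIn q a b) (des-map-punchIn q (b ∷ w))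

des-decode : ∀ {n} (c : LehmerCode n) → des (decode c) ≡ digitDescents (value c) (n ∸ 1)
des-decode []       = refl
des-decode (q ∷ []) = refl
des-decode (_∷_ {suc n} q (s ∷ c)) = begin
  descent (toℕ q) (toℕ (punchIn q s)) + des (map (punchIn q) (decode (s ∷ c)))
    ≡⟨ cong₂ _+_ (descent-pivot-punchIn q s) (trans (des-map-punchIn q (decode (s ∷ c))) (des-decode (s ∷ c))) ⟩
  descent (toℕ q) (toℕ s) + digitDescents v n
    ≡⟨ +-comm (descent (toℕ q) (toℕ s)) (digitDescents v n) ⟩
  digitDescents v n + descent (toℕ q) (toℕ s)
    ≡⟨ cong₂ _+_ lower-descents top-descent ⟨
  digitDescents V n + digitDescent V n
    ≡⟨ sum-upTo-suc (digitDescent V) n ⟨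
  digitDescents V (suc n)
    ∎
  where
  v = value (s ∷ c)
  V = value (q ∷ s ∷ c)
  lower-digit : ∀ {i} → i < suc n → factorialDigit V i ≡ factorialDigit v i
  lower-digit = factorialDigit-+-*-below (toℕ q) v
  top-descent : digitDescent V n ≡ descent (toℕ q) (toℕ s)
  top-descent = cong₂ descent
    (factorialDigit-+-*-top (toℕ q) v (m<1+n⇒m≤n (toℕ<n q)) (value<n! (s ∷ c)))
    (trans (lower-digit ≤-refl) (factorialDigit-+-*-top (toℕ s) (value c) (m<1+n⇒m≤n (toℕ<n s)) (value<n! c)))
  lower-descents : digitDescents V n ≡ digitDescents v n
  lower-descents = cong sum (map-cong-local (All.tabulate λ {i} i∈ →
    let i<n = ∈-upTo⁻ i∈ in cong₂ descent (lower-digit (s≤s i<n)) (lower-digit (m<n⇒m<1+n i<n))))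

floorSum-value : ∀ {n} (c : LehmerCode n) → sum (map (floorTerm (value c)) (upTo (n ∸ 1))) + des (decode c) ≡ value c
floorSum-value []            = refl
floorSum-value (_∷_ {n} q c) = begin
  F + des (decode (q ∷ c))                            ≡⟨ cong (F +_) (des-decode (q ∷ c)) ⟩
  F + digitDescents V n                               ≡⟨ +-identityʳ (F + digitDescents V n) ⟨
  F + digitDescents V n + 0                           ≡⟨ cong (F + digitDescents V n +_) V/[1+n]!≡0 ⟨
  F + digitDescents V n + factorialQuotient V (suc n) ≡⟨ floorSum-telescope V n ⟩
  V                                                   ∎
  where
  instance _ = suc n !≢0
  V = value (q ∷ c)
  F = sum (map (floorTerm V) (upTo n))
  V/[1+n]!≡0 : factorialQuotient V (suc n) ≡ 0
  V/[1+n]!≡0 = trans (factorialQuotient≡/! V (suc n)) (m<n⇒m/n≡0 (value<n! (q ∷ c)))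

+[m+n]-+m≡+n : ∀ m n → ℤ.+ (m + n) - ℤ.+ m ≡ ℤ.+ n
+[m+n]-+m≡+n m n = begin
  ℤ.+ (m + n) - ℤ.+ m  ≡⟨ [+m]-[+n]≡m⊖n (m + n) m ⟩
  (m + n) ⊖ m          ≡⟨ ⊖-≥ (m≤m+n m n) ⟩
  ℤ.+ (m + n ∸ m)      ≡⟨ cong ℤ.+_ (m+n∸m≡n m n) ⟩
  ℤ.+ n                ∎

rhsExp-value : ∀ {d} (c : LehmerCode d) → rhsExp d (value c) ≡ ℤ.+ (1 + des (decode c))
rhsExp-value {d} c = begin
  ℤ.+ (value c + 1) - ℤ.+ F  ≡⟨ cong (λ x → ℤ.+ x - ℤ.+ F) value+1 ⟩
  ℤ.+ (F + (1 + D)) - ℤ.+ F  ≡⟨ +[m+n]-+m≡+n F (1 + D) ⟩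
  ℤ.+ (1 + D)                ∎
  where
  F = sum (map (floorTerm (value c)) (upTo (d ∸ 1)))
  D = des (decode c)
  value+1 : value c + 1 ≡ F + (1 + D)
  value+1 = begin
    value c + 1    ≡⟨ +-comm (value c) 1 ⟩
    suc (value c)  ≡⟨ cong suc (floorSum-value c) ⟨
    suc (F + D)    ≡⟨ +-suc F D ⟨
    F + suc D      ∎

-- Enumerating codes and words

codes : ∀ n → List (LehmerCode n)
codes zero    = [ [] ]
codes (suc n) = cartesianProductWith _∷_ (allFin (suc n)) (codes n)

applyUpTo-+ : ∀ {A : Set} (f : ℕ → A) m n → applyUpTo f (m + n) ≡ applyUpTo f m ++ applyUpTo (f ∘ (m +_)) n
applyUpTo-+ f zero    n = refl
applyUpTo-+ f (suc m) n = cong (f 0 ∷_) (applyUpTo-+ (f ∘ suc) m n)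

upTo-+ : ∀ m n → upTo (m + n) ≡ upTo m ++ map (m +_) (upTo n)
upTo-+ m n = trans (applyUpTo-+ id m n) (cong (upTo m ++_) (sym (map-upTo (m +_) n)))

concatMap-upTo-* : ∀ k m → concatMap (λ q → map (q * m +_) (upTo m)) (upTo k) ≡ upTo (k * m)
concatMap-upTo-* zero    m = refl
concatMap-upTo-* (suc k) m = begin
  concatMap block (upTo (suc k))               ≡⟨ cong (concatMap block) (upTo-∷ʳ k) ⟨
  concatMap block (upTo k ++ [ k ])            ≡⟨ concatMap-++ block (upTo k) [ k ] ⟩
  concatMap block (upTo k) ++ (block k ++ [])  ≡⟨ cong₂ _++_ (concatMap-upTo-* k m) (++-identityʳ (block k)) ⟩
  upTo (k * m) ++ map (k * m +_) (upTo m)      ≡⟨ upTo-+ (k * m) m ⟨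
  upTo (k * m + m)                             ≡⟨ cong upTo (+-comm (k * m) m) ⟩
  upTo (suc k * m)                             ∎
  where
  block = λ q → map (q * m +_) (upTo m)

map-toℕ-allFin : ∀ n → map toℕ (allFin n) ≡ upTo n
map-toℕ-allFin n = trans (map-tabulate id toℕ) (tabulate-toℕ n id)
  where
  tabulate-toℕ : ∀ {A : Set} n (f : ℕ → A) → tabulate {n = n} (f ∘ toℕ) ≡ applyUpTo f n
  tabulate-toℕ zero    f = refl
  tabulate-toℕ (suc n) f = cong (f 0 ∷_) (tabulate-toℕ n (f ∘ suc))

map-value-cartesianProduct : ∀ {n} (qs : List (Fin (suc n))) (cs : List (LehmerCode n)) →
  map value (cartesianProductWith _∷_ qs cs) ≡ concatMap (λ q → map (q * n ! +_) (map value cs)) (map toℕ qs)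
map-value-cartesianProduct     []       cs = refl
map-value-cartesianProduct {n} (q ∷ qs) cs = begin
  map value (map (q ∷_) cs ++ cartesianProductWith _∷_ qs cs)
    ≡⟨ map-++ value (map (q ∷_) cs) _ ⟩
  map value (map (q ∷_) cs) ++ map value (cartesianProductWith _∷_ qs cs)
    ≡⟨ cong₂ _++_ (trans (sym (map-∘ cs)) (map-∘ cs)) (map-value-cartesianProduct qs cs) ⟩
  map (toℕ q * n ! +_) (map value cs) ++ _
    ∎

map-value-codes : ∀ n → map value (codes n) ≡ upTo (n !)
map-value-codes zero    = refl
map-value-codes (suc n) = begin
  map value (codes (suc n))
    ≡⟨ map-value-cartesianProduct (allFin (suc n)) (codes n) ⟩
  concatMap (λ q → map (q * n ! +_) (map value (codes n))) (map toℕ (allFin (suc n)))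
    ≡⟨ cong₂ (λ vs qs → concatMap (λ q → map (q * n ! +_) vs) qs) (map-value-codes n) (map-toℕ-allFin (suc n)) ⟩
  concatMap (λ q → map (q * n ! +_) (upTo (n !))) (upTo (suc n))
    ≡⟨ concatMap-upTo-* (suc n) (n !) ⟩
  upTo (suc n !)
    ∎

length-decode : ∀ {n} (c : LehmerCode n) → length (decode c) ≡ n
length-decode []      = refl
length-decode (q ∷ c) = cong suc (trans (length-map (punchIn q) (decode c)) (length-decode c))

decode-unique : ∀ {n} (c : LehmerCode n) → Unique (decode c)
decode-unique []      = []
decode-unique (q ∷ c) = All.tabulate pivot-fresh ∷ Unique.map⁺ (punchIn-injective q _ _) (decode-unique c)
  where
  pivot-fresh : ∀ {x} → x ∈ map (punchIn q) (decode c) → q ≢ x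
  pivot-fresh x∈ q≡x with ∈-map⁻ (punchIn q) x∈
  ... | y , _ , refl = punchInᵢ≢i q y (sym q≡x)

decode-injective : ∀ {n} {c c′ : LehmerCode n} → decode c ≡ decode c′ → c ≡ c′
decode-injective {c = []}    {[]}      _  = refl
decode-injective {c = q ∷ c} {q′ ∷ c′} eq with ∷-injective eq
... | refl , eq′ = cong (q ∷_) (decode-injective (map-injective (punchIn-injective q _ _) eq′))

punchOut-all : ∀ {n} (q : Fin (suc n)) w → All (q ≢_) w → ∃[ v ] map (punchIn q) v ≡ w
punchOut-all q []      []          = [] , refl
punchOut-all q (x ∷ w) (q≢x ∷ q∉w) with punchOut-all q w q∉w
... | v , refl = punchOut q≢x ∷ v , cong (_∷ map (punchIn q) v) (punchIn-punchOut q≢x)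

decode-surjective : ∀ {n} (w : List (Fin n)) → length w ≡ n → Unique w → ∃[ c ] decode c ≡ w
decode-surjective {zero}  []      _   _            = [] , refl
decode-surjective {suc n} (q ∷ w) len (q∉w ∷ uniq) with punchOut-all q w q∉w
... | v , refl with decode-surjective v (suc-injective (trans (cong suc (sym (length-map (punchIn q) v))) len)) (Unique.map⁻ uniq)
... | c , refl = q ∷ c , refl

concatMap≡cartesianProductWith : ∀ {A B C : Set} (f : A → B → C) xs ys →
                                 concatMap (λ x → map (f x) ys) xs ≡ cartesianProductWith f xs ys
concatMap≡cartesianProductWith f []       ys = refl
concatMap≡cartesianProductWith f (x ∷ xs) ys = cong (map (f x) ys ++_) (concatMap≡cartesianProductWith f xs ys)

words-suc : ∀ d n → words d (suc n) ≡ cartesianProductWith (λ w a → a ∷ w) (words d n) (allFin d)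
words-suc d n = concatMap≡cartesianProductWith (λ w a → a ∷ w) (words d n) (allFin d)

∈-words⁺ : ∀ {d} n (w : List (Fin d)) → length w ≡ n → w ∈ words d n
∈-words⁺     zero    []      refl = here refl
∈-words⁺ {d} (suc n) (a ∷ w) refl = subst (a ∷ w ∈_) (sym (words-suc d n))
  (∈-cartesianProductWith⁺ (λ w a → a ∷ w) (∈-words⁺ n w refl) (∈-allFin a))

length-∈-words : ∀ {d} n {w : List (Fin d)} → w ∈ words d n → length w ≡ n
length-∈-words     zero    (here refl) = refl
length-∈-words {d} (suc n) w∈
  with ∈-cartesianProductWith⁻ (λ w a → a ∷ w) (words d n) (allFin d) (subst (_ ∈_) (words-suc d n) w∈)
... | _ , _ , u∈ , _ , refl = cong suc (length-∈-words n u∈)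

words-unique : ∀ d n → Unique (words d n)
words-unique d zero    = [] ∷ []
words-unique d (suc n) = subst Unique (sym (words-suc d n))
  (Unique.cartesianProductWith⁺ (λ w a → a ∷ w) ∷-injective-flipped (words-unique d n) (Unique.allFin⁺ d))
  where
  ∷-injective-flipped : ∀ {w u : List (Fin d)} {a b} → a ∷ w ≡ b ∷ u → w ≡ u × a ≡ b
  ∷-injective-flipped refl = refl , refl

∈-codes : ∀ {n} (c : LehmerCode n) → c ∈ codes n
∈-codes []      = here refl
∈-codes (q ∷ c) = ∈-cartesianProductWith⁺ _∷_ (∈-allFin q) (∈-codes c)

codes-unique : ∀ n → Unique (codes n)
codes-unique zero    = [] ∷ []
codes-unique (suc n) = Unique.cartesianProductWith⁺ _∷_ ∷-injectiveᶜ (Unique.allFin⁺ (suc n)) (codes-unique n)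
  where
  ∷-injectiveᶜ : ∀ {q q′ : Fin (suc n)} {c c′} → q ∷ c ≡ q′ ∷ c′ → q ≡ q′ × c ≡ c′
  ∷-injectiveᶜ refl = refl , refl

perms↭map-decode : ∀ d → perms d ↭ map decode (codes d)
perms↭map-decode d = ∼bag⇒↭ (unique∧set⇒bag
  (Unique.filter⁺ (unique? Fin._≟_) (words-unique d d))
  (Unique.map⁺ decode-injective (codes-unique d))
  (mk⇔ to from))
  where
  to : ∀ {w} → w ∈ perms d → w ∈ map decode (codes d)
  to w∈ with ∈-filter⁻ (unique? Fin._≟_) w∈
  ... | w∈words , uniq with decode-surjective _ (length-∈-words d w∈words) uniq
  ... | c , refl = ∈-map⁺ decode (∈-codes c)
  from : ∀ {w} → w ∈ map decode (codes d) → w ∈ perms d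
  from w∈ with ∈-map⁻ decode w∈
  ... | c , _ , refl = ∈-filter⁺ (unique? Fin._≟_) (∈-words⁺ d (decode c) (length-decode c)) (decode-unique c)

coeff-↭ : ∀ {es es′} k → es ↭ es′ → coeff es k ≡ coeff es′ k
coeff-↭ k p = ↭-length (filter-↭ (ℤ._≟ k) p)

-- The identity also holds for d = 0.
corollary6p5 : (d : ℕ) → 1 ≤ d → (k : ℤ) → coeff (eulerianExps d) k ≡ coeff (rhsExps d) k
corollary6p5 d _ k = trans (coeff-↭ k (map⁺ E (perms↭map-decode d))) (cong (λ es → coeff es k) exponents)
  where
  E : List (Fin d) → ℤ
  E π = ℤ.+ (1 + des π)
  exponents : map E (map decode (codes d)) ≡ rhsExps d
  exponents = begin
    map E (map decode (codes d))          ≡⟨ map-∘ (codes d) ⟨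
    map (E ∘ decode) (codes d)            ≡⟨ map-cong (sym ∘ rhsExp-value) (codes d) ⟩
    map (rhsExp d ∘ value) (codes d)      ≡⟨ map-∘ (codes d) ⟩
    map (rhsExp d) (map value (codes d))  ≡⟨ cong (map (rhsExp d)) (map-value-codes d) ⟩
    map (rhsExp d) (upTo (d !))           ∎
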